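{- Let $\mathcal{S}$ be a nonempty set, let $\mathcal{B}$ be a scene space basis on $\mathcal{S}$, and let $\mathfrak{S}_{\mathcal{B}}$ be the scene space over $\mathcal{B}$. Then $\mathfrak{S}_{\mathcal{B}}$, ordered by the scene order $\le$, is a complete Boolean algebra in which the supremum of a subset $X \subseteq \mathfrak{S}_{\mathcal{B}}$ is $\bigcup X$ and the complement of $A \in \mathfrak{S}_{\mathcal{B}}$ is $A^{\complement}$.
   Context: Scenes. Let $\mathcal{S}$ be a nonempty set. A scene on $\mathcal{S}$ is a function $F:\mathcal{S}\to\mathcal{S}\to\mathcal{S}$ (its merge function) satisfying, for all $x,y,z\in\mathcal{S}$: $F\,(F\,x\,y)\,z = F\,x\,z$, $F\,x\,(F\,y\,z)=F\,x\,z$, and $F\,x\,x=x$. Operations: $\bot = (\lambda s_1\,s_2.\ s_1)$, $\top=(\lambda s_1\,s_2.\ s_2)$, $F^{\complement}=(\lambda s_1\,s_2.\ F\,s_2\,s_1)$, $F\sqcup G=(\lambda s_1\,s_2.\ G\,(F\,s_1\,s_2)\,s_2)$. Independence: scenes $F,G$ are independent if $G\,(F\,s_1\,s_2)\,s_3=F\,(G\,s_1\,s_3)\,s_2$ for all $s_1,s_2,s_3\in\mathcal{S}$. Scene order: $F\le G$ iff $F\,(G\,s_1\,s_2)\,s_3=G\,s_1\,(F\,s_2\,s_3)$ for all $s_1,s_2,s_3\in\mathcal{S}$. Scene space basis: a finite sequence of scenes $S_1,\dots,S_n$ on $\mathcal{S}$ such that $S_i$ and $S_j$ are independent whenever $i\ne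 j$, and $S_1\sqcup S_2\sqcup\cdots\sqcup S_n=\top$; write $\mathcal{B}=\{S_1,\dots,S_n\}$. Scene space: $\mathfrak{S}_{\mathcal{B}}$ is the smallest set of scenes on $\mathcal{S}$ that contains $\bot$ and every element of $\mathcal{B}$ and is closed under $\sqcup$; it is finite. For a finite set $X=\{A_1,\dots,A_m\}\subseteq\mathfrak{S}_{\mathcal{B}}$, $\bigcup X = A_1\sqcup\cdots\sqcup A_m$ (with $\bigcup\emptyset=\bot$); within a scene space the result does not depend on the order of enumeration. -}

module Defs where

open import Level using (Level; suc) renaming (_⊔_ to _⊔ˡ_)
open import Data.List.Base using (List)
import Data.List.Base as List
open import Data.List.Relation.Unary.All using (All)
open import Data.List.Relation.Unary.Any using (Any)
open import Data.Nat.Base using (ℕ)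
open import Data.Product.Base using (Σ; ∃; _×_; _,_; proj₁; proj₂)
open import Data.Vec.Functional using (Vector)
import Data.Vec.Functional as Vector
open import Relation.Binary.Core using (Rel)
open import Relation.Binary.PropositionalEquality using (_≡_; _≢_)
open import Relation.Unary using (Pred)

private
  variable
    a ℓ p : Level
    S : Set a
    n : ℕ

-- The operations below are defined on arbitrary merge functions, because
-- F ⊔ G need not satisfy the scene laws for arbitrary scenes F and G.

Merge : Set a → Set a
Merge S = S → S → S

record IsScene {a : Level} {S : Set a} (F : Merge S) : Set a where
  field
    overrideˡ  : ∀ x y z → F (F x y) z ≡ F x z
    overrideʳ  : ∀ x y z → F x (F y z) ≡ F x z
    idempotent : ∀ x → F x x ≡ x

record Scene {a : Level} (S : Set a) : Set a where
  field
    merge   : Merge S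
    isScene : IsScene merge

open Scene public

infix  4 _≈_ _≤_
infixl 6 _⊔_
infix  8 _ᶜ

_≈_ : Rel (Merge S) _
F ≈ G = ∀ s₁ s₂ → F s₁ s₂ ≡ G s₁ s₂

⊥ : Merge S
⊥ s₁ s₂ = s₁

⊤ : Merge S
⊤ s₁ s₂ = s₂

_ᶜ : Merge S → Merge S
(F ᶜ) s₁ s₂ = F s₂ s₁

_⊔_ : Merge S → Merge S → Merge S
(F ⊔ G) s₁ s₂ = G (F s₁ s₂) s₂

Independent : Rel (Merge S) _
Independent F G = ∀ s₁ s₂ s₃ → G (F s₁ s₂) s₃ ≡ F (G s₁ s₃) s₂

_≤_ : Rel (Merge S) _
F ≤ G = ∀ s₁ s₂ s₃ → F (G s₁ s₂) s₃ ≡ G s₁ (F s₂ s₃)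

-- ⊔ is associative with unit ⊥ (definitionally), so the bracketing of
-- iterated joins is immaterial.
record Basis {a : Level} (S : Set a) (n : ℕ) : Set a where
  field
    scenes      : Vector (Scene S) n
    independent : ∀ {i j} → i ≢ j → Independent (merge (scenes i)) (merge (scenes j))
    total       : Vector.foldr _⊔_ ⊥ (λ i → merge (scenes i)) ≈ ⊤

-- Functions are identified when they agree pointwise; `resp` makes
-- membership respect this identification.
data InSpace {a : Level} {S : Set a} {n : ℕ} (B : Basis S n) : Pred (Merge S) a where
  bot  : InSpace B ⊥
  base : ∀ i → InSpace B (merge (Basis.scenes B i))
  join : ∀ {F G} → InSpace B F → InSpace B G → InSpace B (F ⊔ G)
  resp : ∀ {F G} → F ≈ G → InSpace B F → InSpace B G

Space : {S : Set a} → Basis S n → Set a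
Space {S = S} B = Σ (Merge S) (InSpace B)

module _ {a : Level} {S : Set a} {n : ℕ} (B : Basis S n) where

  SpaceEq : Rel (Space B) a
  SpaceEq A A′ = proj₁ A ≈ proj₁ A′

  SpaceOrder : Rel (Space B) a
  SpaceOrder A A′ = proj₁ A ≤ proj₁ A′

  spaceBot : Space B
  spaceBot = ⊥ , bot

  spaceJoin : Space B → Space B → Space B
  spaceJoin (F , F∈) (G , G∈) = F ⊔ G , join F∈ G∈

  spaceCompl : (∀ F → InSpace B F → InSpace B (F ᶜ)) → Space B → Space B
  spaceCompl closed (F , F∈) = F ᶜ , closed F F∈

  ⋃ : List (Space B) → Space B
  ⋃ = List.foldr spaceJoin spaceBot

module _ {a ℓ p : Level} {A : Set a} (_≼_ : Rel A ℓ) where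

  IsSupremum : Pred A p → Pred A (a ⊔ˡ ℓ ⊔ˡ p)
  IsSupremum X u = (∀ x → X x → x ≼ u) × (∀ v → (∀ x → X x → x ≼ v) → u ≼ v)

  IsInfimum : Pred A p → Pred A (a ⊔ˡ ℓ ⊔ˡ p)
  IsInfimum X u = (∀ x → X x → u ≼ x) × (∀ v → (∀ x → X x → v ≼ x) → v ≼ u)

  IsComplete : Set (a ⊔ˡ ℓ ⊔ˡ suc p)
  IsComplete = ∀ (X : Pred A p) → ∃ (IsSupremum X) × ∃ (IsInfimum X)

-- `xs` lists the subset X of a setoid, where X itself is not required to
-- respect the setoid equality.
Enumerates : {A : Set a} → Rel A ℓ → List A → Pred A p → Set (a ⊔ˡ ℓ ⊔ˡ p)
Enumerates _∼_ xs X = All X xs × (∀ x → X x → Any (x ∼_) xs)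

{-# OPTIONS --safe #-}
-- Say that s and t agree at coordinate i when the basis scene Sᵢ cannot tell
-- them apart as second arguments.  Totality of the basis makes a state
-- determined by its coordinates, and every element F of the space selects, at
-- each coordinate, one of its two arguments: F s t agrees there either always
-- with s or always with t.  So F is determined by a Boolean mask, on which ⊔
-- and ᶜ act as ∨ and not, and every law reduces to a case distinction on bits.
-- Masks are not unique: at a coordinate where all states agree the bit is
-- irrelevant, and F ≤ G compares masks except at such coordinates.
module Submission where

open import Level using (Level; _⊔_)
open import Axiom.ExcludedMiddle using (ExcludedMiddle)
open import Data.Bool.Base using (Bool; true; false; if_then_else_; not; _∧_; _∨_)
open import Data.Bool.Properties using (∧-identityʳ; ∧-zeroʳ; ∨-identityʳ)
open import Data.Fin.Base using (Fin; zero; suc)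
open import Data.Fin.Properties using (_≟_)
open import Data.List.Base using (List; []; _∷_; foldr; cartesianProductWith)
open import Data.List.Membership.Propositional using (_∈_)
open import Data.List.Membership.Propositional.Properties using (∈-cartesianProductWith⁺)
open import Data.List.Relation.Unary.All as All using (All; []; _∷_)
open import Data.List.Relation.Unary.Any using (Any; here; there)
open import Data.Nat.Base using (ℕ; zero; suc)
open import Data.Product.Base using (Σ-syntax; ∃-syntax; _×_; _,_; proj₁; proj₂)
open import Data.Unit.Polymorphic.Base using (tt) renaming (⊤ to Unit)
open import Data.Vec.Base using (Vec; []; _∷_; lookup; tabulate)
open import Data.Vec.Functional as Vector using (Vector)
open import Data.Vec.Properties using (lookup∘tabulate)
open import Function.Base using (_∘_)
open import Relation.Binary.Core using (Rel)
open import Relation.Binary.Definitions using (Reflexive; Symmetric; Transitive; Maximum)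
open import Relation.Binary.Lattice.Bundles using (BoundedJoinSemilattice; BoundedLattice)
open import Relation.Binary.Lattice.Definitions using (Supremum; Infimum; Exponential)
open import Relation.Binary.Lattice.Properties.BoundedMeetSemilattice
  using (dualBoundedJoinSemilattice)
open import Relation.Binary.Lattice.Structures using (IsBooleanAlgebra)
open import Relation.Binary.PropositionalEquality
  using (_≡_; refl; sym; trans; cong; cong₂; subst)
open import Relation.Binary.Structures using (IsPartialOrder)
open import Relation.Nullary.Decidable using (does; yes; no)
open import Relation.Nullary.Negation using (contradiction)
open import Relation.Unary using (Pred)
open import Defs hiding (_⊔_)
open Defs using () renaming (_⊔_ to _⊔ₛ_)

-- Suprema of finite lists, and enumeration of subsets by codes.

module _ {c ℓ₁ ℓ₂} (J : BoundedJoinSemilattice c ℓ₁ ℓ₂) where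
  private module J = BoundedJoinSemilattice J

  foldr-upper : ∀ {x} xs → Any (x J.≈_) xs → x J.≤ foldr J._∨_ J.⊥ xs
  foldr-upper (y ∷ ys) (here x≈y)   = J.trans (J.reflexive x≈y) (J.x≤x∨y _ _)
  foldr-upper (y ∷ ys) (there x∈ys) = J.trans (foldr-upper ys x∈ys) (J.y≤x∨y _ _)

  foldr-least : ∀ {v xs} → All (J._≤ v) xs → foldr J._∨_ J.⊥ xs J.≤ v
  foldr-least []         = J.minimum _
  foldr-least (y≤v ∷ ys) = J.∨-least y≤v (foldr-least ys)

  -- Kept abstract in the semilattice so that it serves both `⋃` and, through the dual order,
  -- infima.
  foldr-supremum : ∀ {p} {X : Pred J.Carrier p} {xs} → Enumerates J._≈_ xs X →
                   IsSupremum J._≤_ X (foldr J._∨_ J.⊥ xs)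
  foldr-supremum {xs = xs} (xs⊆X , X⊆xs) =
    (λ x x∈X → foldr-upper xs (X⊆xs x x∈X)) ,
    (λ v X≤v → foldr-least (All.map (X≤v _) xs⊆X))

module _ {a k ℓ p q : Level} {A : Set a} {K : Set k} {_∼_ : Rel A ℓ}
         {R : K → Pred A q} (unique : ∀ {κ x y} → R κ x → R κ y → x ∼ y)
         (X : Pred A p) (em : ExcludedMiddle (a ⊔ p ⊔ q)) where

  -- By `unique`, members of `X` sharing a code are equivalent, so one representative per code
  -- suffices; excluded middle decides whether a code has one. An element may have several codes, so
  -- the list may repeat it.
  enumerateByCode : ∀ κs → ∃[ xs ] All X xs ×
    (∀ {κ x} → κ ∈ κs → R κ x → X x → Any (x ∼_) xs)
  enumerateByCode [] = [] , [] , λ ()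
  enumerateByCode (κ ∷ κs) with enumerateByCode κs | em {∃[ x ] (R κ x × X x)}
  ... | xs , all , cover | yes (y , κy , y∈X) = y ∷ xs , y∈X ∷ all , λ
    { (here refl) κx _ → here (unique κx κy)
    ; (there κ∈)  κx x∈X → there (cover κ∈ κx x∈X) }
  ... | xs , all , cover | no ∄y = xs , all , λ
    { (here refl) κx x∈X → contradiction (_ , κx , x∈X) ∄y
    ; (there κ∈)  κx x∈X → cover κ∈ κx x∈X }

-- Boolean vectors and disjunctions of bits.

masks : ∀ n → List (Vec Bool n)
masks zero    = [] ∷ []
masks (suc n) = cartesianProductWith _∷_ (true ∷ false ∷ []) (masks n)

-- First-order vectors serve as codes because membership is up to propositional equality; for
-- functions into `Bool` this would require extensionality.
∈-masks : ∀ {n} (v : Vec Bool n) → v ∈ masks n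
∈-masks []      = here refl
∈-masks (b ∷ v) = ∈-cartesianProductWith⁺ _∷_ (∈-bools b) (∈-masks v)
  where
  ∈-bools : ∀ b → b ∈ (true ∷ false ∷ [])
  ∈-bools true  = here refl
  ∈-bools false = there (here refl)

or-false : ∀ {n} {β : Vector Bool n} → (∀ i → β i ≡ false) →
           Vector.foldr _∨_ false β ≡ false
or-false {zero}  β≡f = refl
or-false {suc n} β≡f = cong₂ _∨_ (β≡f zero) (or-false (β≡f ∘ suc))

-- A basis scene has a unit vector as mask, so the left side is bit `i` of the join of the basis
-- scenes chosen by `β`.
or-at : ∀ {n} (β : Vector Bool n) i →
        Vector.foldr _∨_ false (λ j → β j ∧ does (j ≟ i)) ≡ β i
or-at β zero = trans
  (cong₂ _∨_ (∧-identityʳ (β zero)) (or-false (λ j → ∧-zeroʳ (β (suc j)))))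
  (∨-identityʳ (β zero))
or-at β (suc i) = cong₂ _∨_ (∧-zeroʳ (β zero)) (or-at (β ∘ suc) i)

-- Iterated joins and agreement of states at coordinates.

⨆ : ∀ {a} {S : Set a} {m} → Vector (Merge S) m → Merge S
⨆ = Vector.foldr _⊔ₛ_ ⊥

⨆-fixes : ∀ {a} {S : Set a} {m} (F : Vector (Merge S) m) {s t} →
          (∀ j → F j s t ≡ s) → ⨆ F s t ≡ s
⨆-fixes {m = zero}  F fix = refl
⨆-fixes {m = suc m} F {s} {t} fix = trans
  (cong (λ u → ⨆ (F ∘ suc) u t) (fix zero))
  (⨆-fixes (F ∘ suc) (fix ∘ suc))

module _ {a : Level} {S : Set a} {n : ℕ} (B : Basis S n) where
  open Basis B

  private
    at : Fin n → Merge S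
    at i = merge (scenes i)

    module At i = IsScene (isScene (scenes i))

  Agree : Fin n → Rel S a
  Agree i s t = ∀ r → at i r s ≡ at i r t

  module _ {i : Fin n} where
    agree-refl : Reflexive (Agree i)
    agree-refl r = refl

    agree-sym : Symmetric (Agree i)
    agree-sym p r = sym (p r)

    agree-trans : Transitive (Agree i)
    agree-trans p q r = trans (p r) (q r)

    agree-reflexive : ∀ {s t} → s ≡ t → Agree i s t
    agree-reflexive s≡t r = cong (at i r) s≡t

    -- Rewrite `s` as `at i s t` inside `at i r s`; the second override law then drops the inner
    -- `s`.
    fixed⇒agree : ∀ {s t} → at i s t ≡ s → Agree i s t
    fixed⇒agree {s} {t} eq r = trans (cong (at i r) (sym eq)) (At.overrideʳ i r s t)

  -- Agreement at `i` gives `at i s t ≡ at i s s ≡ s`. Hence the join of the whole basis fixes `s`,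
  -- while totality says that it returns `t`.
  agree-everywhere : ∀ {s t} → (∀ i → Agree i s t) → s ≡ t
  agree-everywhere {s} {t} s~t = trans
    (sym (⨆-fixes at (λ i → trans (sym (s~t i s)) (At.idempotent i s))))
    (total s t)

  -- Selected bits, masks and membership in the space.

  Selects : Fin n → Bool → Pred (Merge S) a
  Selects i b F = ∀ s t → Agree i (F s t) (if b then t else s)

  module _ {i : Fin n} where

    selects-⊔ : ∀ {b c F G} → Selects i b F → Selects i c G → Selects i (b ∨ c) (F ⊔ₛ G)
    selects-⊔ {true}  {true}  f g s t = g _ t
    selects-⊔ {true}  {false} f g s t = agree-trans (g _ t) (f s t)
    selects-⊔ {false} {true}  f g s t = g _ t
    selects-⊔ {false} {false} f g s t = agree-trans (g _ t) (f s t)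

    selects-ᶜ : ∀ {b F} → Selects i b F → Selects i (not b) (F ᶜ)
    selects-ᶜ {true}  f s t = f t s
    selects-ᶜ {false} f s t = f t s

    selects-⨆ : ∀ {m} {β : Vector Bool m} {F : Vector (Merge S) m} →
                (∀ j → Selects i (β j) (F j)) →
                Selects i (Vector.foldr _∨_ false β) (⨆ F)
    selects-⨆ {zero}  f s t = agree-refl
    selects-⨆ {suc m} f = selects-⊔ (f zero) (selects-⨆ (f ∘ suc))

  -- At its own coordinate this is the second override law. At another one, independence and
  -- idempotence give `at i (at j s t) s ≡ at j (at i s s) t ≡ at j s t`, so `fixed⇒agree` applies.
  selects-at : ∀ j i → Selects i (does (j ≟ i)) (at j)
  selects-at j i s t with j ≟ i
  ... | yes refl = λ r → At.overrideʳ i r s t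
  ... | no  j≢i  = fixed⇒agree
    (trans (independent j≢i s t s) (cong (λ u → at j u t) (At.idempotent i s)))

  HasMask : Vector Bool n → Pred (Merge S) a
  HasMask β F = ∀ i → Selects i (β i) F

  -- The mask depends on the derivation of membership: two derivations for one `F` can differ at
  -- coordinates where all states agree.
  mask : ∀ {F} → InSpace B F → Vector Bool n
  mask bot          i = false
  mask (base j)     i = does (j ≟ i)
  mask (join f g)   i = mask f i ∨ mask g i
  mask (resp F≈G f) i = mask f i

  hasMask : ∀ {F} (F∈ : InSpace B F) → HasMask (mask F∈) F
  hasMask bot          i s t = agree-refl
  hasMask (base j)     i     = selects-at j i
  hasMask (join f g)   i     = selects-⊔ (hasMask f i) (hasMask g i)
  hasMask (resp F≈G f) i s t =
    agree-trans (agree-reflexive (sym (F≈G s t))) (hasMask f i s t)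

  hasMask-unique : ∀ {β F G} → HasMask β F → HasMask β G → F ≈ G
  hasMask-unique f g s t = agree-everywhere λ i →
    agree-trans (f i s t) (agree-sym (g i s t))

  hasMask-⊤ : HasMask (λ _ → true) ⊤
  hasMask-⊤ i s t = agree-refl

  fromMask : Vector Bool n → Merge S
  fromMask β = ⨆ λ j → if β j then at j else ⊥

  fromMask-hasMask : ∀ β → HasMask β (fromMask β)
  fromMask-hasMask β i = subst (λ b → Selects i b (fromMask β)) (or-at β i)
    (selects-⨆ λ j → piece (β j) j)
    where
    piece : ∀ b j → Selects i (b ∧ does (j ≟ i)) (if b then at j else ⊥)
    piece true  j     = selects-at j i
    piece false j s t = agree-refl

  ⨆∈ : ∀ {m} {F : Vector (Merge S) m} → (∀ j → InSpace B (F j)) → InSpace B (⨆ F)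
  ⨆∈ {zero}  F∈ = bot
  ⨆∈ {suc m} F∈ = join (F∈ zero) (⨆∈ (F∈ ∘ suc))

  fromMask∈ : ∀ β → InSpace B (fromMask β)
  fromMask∈ β = ⨆∈ λ j → piece (β j) j
    where
    piece : ∀ b j → InSpace B (if b then at j else ⊥)
    piece true  j = base j
    piece false j = bot

  -- Having a mask forces equality with a join of basis scenes. This puts `⊤` and complements into
  -- the space, although no constructor mentions them.
  hasMask⇒∈ : ∀ {β F} → HasMask β F → InSpace B F
  hasMask⇒∈ {β} f = resp (hasMask-unique (fromMask-hasMask β) f) (fromMask∈ β)

  -- At each coordinate `F` acts as a projection, and both projections satisfy the scene laws.
  hasMask⇒isScene : ∀ {β F} → HasMask β F → IsScene F
  hasMask⇒isScene {β} {F} f = record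
    { overrideˡ  = λ x y z → agree-everywhere λ i → overˡ x y z (β i) (f i)
    ; overrideʳ  = λ x y z → agree-everywhere λ i → overʳ x y z (β i) (f i)
    ; idempotent = λ x → agree-everywhere λ i → idem x (β i) (f i)
    }
    where
    module _ {i : Fin n} where
      overˡ : ∀ x y z b → Selects i b F → Agree i (F (F x y) z) (F x z)
      overˡ x y z true  f = agree-trans (f _ z) (agree-sym (f x z))
      overˡ x y z false f = agree-trans (f _ z) (agree-trans (f x y) (agree-sym (f x z)))

      overʳ : ∀ x y z b → Selects i b F → Agree i (F x (F y z)) (F x z)
      overʳ x y z true  f = agree-trans (f x _) (agree-trans (f y z) (agree-sym (f x z)))
      overʳ x y z false f = agree-trans (f x _) (agree-sym (f x z))

      idem : ∀ x b → Selects i b F → Agree i (F x x) x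
      idem x true  f = f x x
      idem x false f = f x x

  -- The scene order in terms of bits.

  BitLe : Fin n → Rel Bool a
  BitLe i true  false = ∀ s t → Agree i s t
  BitLe i true  true  = Unit
  BitLe i false c     = Unit

  module _ {i : Fin n} where

    bitLe-refl : Reflexive (BitLe i)
    bitLe-refl {true}  = tt
    bitLe-refl {false} = tt

    bitLe-trans : Transitive (BitLe i)
    bitLe-trans {true}  {true}  {c}     p q = q
    bitLe-trans {true}  {false} {true}  p q = tt
    bitLe-trans {true}  {false} {false} p q = p
    bitLe-trans {false}                 p q = tt

    bitLe-maximum : Maximum (BitLe i) true
    bitLe-maximum true  = tt
    bitLe-maximum false = tt

    bitLe-supremum : Supremum (BitLe i) _∨_
    bitLe-supremum true  true  = tt , tt , λ z p q → p
    bitLe-supremum true  false = tt , tt , λ z p q → p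
    bitLe-supremum false c     = tt , bitLe-refl , λ z p q → q

    -- The De Morgan form matches the meet of the space, which is built from `ᶜ` and `⊔`.
    bitLe-infimum : Infimum (BitLe i) (λ b c → not (not b ∨ not c))
    bitLe-infimum true  true  = tt , tt , λ z p q → p
    bitLe-infimum true  false = tt , tt , λ z p q → q
    bitLe-infimum false c     = tt , tt , λ z p q → p

    bitLe-exponential :
      Exponential (BitLe i) (λ b c → not (not b ∨ not c)) (λ b c → not b ∨ c)
    bitLe-exponential true  true  true  = (λ p → p) , (λ p → p)
    bitLe-exponential true  true  false = (λ p → p) , (λ p → p)
    bitLe-exponential true  false y     = (λ p → tt) , (λ p → tt)
    bitLe-exponential false x     y     = (λ p → tt) , (λ p → tt)

    -- `BitLe i` is only a preorder: distinct bits lie below each other when all states agree at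
    -- `i`, so the conclusion is agreement of values, not equality of bits.
    agree-antisym : ∀ {b c F G} → Selects i b F → Selects i c G →
                    BitLe i b c → BitLe i c b → ∀ s t → Agree i (F s t) (G s t)
    agree-antisym {true}  {true}  f g p q s t = agree-trans (f s t) (agree-sym (g s t))
    agree-antisym {true}  {false} f g p q s t = p _ _
    agree-antisym {false} {true}  f g p q s t = q _ _
    agree-antisym {false} {false} f g p q s t = agree-trans (f s t) (agree-sym (g s t))

    -- For bits `true` and `false`, the two sides of `F (G s s) t ≡ G s (F s t)` agree with `t` and
    -- `s` respectively, so any two states agree.
    ≤⇒bitLe : ∀ {b c F G} → Selects i b F → Selects i c G → F ≤ G → BitLe i b c
    ≤⇒bitLe {true}  {false} f g F≤G s t = agree-trans (agree-sym (g s _))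
      (agree-trans (agree-reflexive (sym (F≤G s s t))) (f _ t))
    ≤⇒bitLe {true}  {true}  f g F≤G = tt
    ≤⇒bitLe {false}         f g F≤G = tt

    -- Both sides select `r`, `t` or `s` for the bit pairs true-true, false-true and false-false.
    -- For true-false they select `r` and `s`, which the hypothesis makes agree.
    bitLe⇒agree : ∀ {b c F G} → Selects i b F → Selects i c G → BitLe i b c →
                  ∀ s t r → Agree i (F (G s t) r) (G s (F t r))
    bitLe⇒agree {true}  {true}  f g p s t r =
      agree-trans (f _ r) (agree-sym (agree-trans (g s _) (f t r)))
    bitLe⇒agree {true}  {false} f g p s t r = p _ _
    bitLe⇒agree {false} {true}  f g p s t r =
      agree-trans (f _ r) (agree-trans (g s t) (agree-sym (agree-trans (g s _) (f t r))))
    bitLe⇒agree {false} {false} f g p s t r =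
      agree-trans (f _ r) (agree-trans (g s t) (agree-sym (g s _)))

  module _ {β γ F G} (f : HasMask β F) (g : HasMask γ G) where

    ≤⇒mask : F ≤ G → ∀ i → BitLe i (β i) (γ i)
    ≤⇒mask F≤G i = ≤⇒bitLe (f i) (g i) F≤G

    mask⇒≤ : (∀ i → BitLe i (β i) (γ i)) → F ≤ G
    mask⇒≤ β≤γ s t r = agree-everywhere λ i → bitLe⇒agree (f i) (g i) (β≤γ i) s t r

  -- The Boolean algebra structure.

  ⊤∈ : InSpace B ⊤
  ⊤∈ = hasMask⇒∈ hasMask-⊤

  hasMask-ᶜ : ∀ {β F} → HasMask β F → HasMask (not ∘ β) (F ᶜ)
  hasMask-ᶜ f i = selects-ᶜ (f i)

  ᶜ∈ : ∀ F → InSpace B F → InSpace B (F ᶜ)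
  ᶜ∈ F F∈ = hasMask⇒∈ (hasMask-ᶜ (hasMask F∈))

  private
    _∪_ _∩_ : Space B → Space B → Space B
    _∪_ = spaceJoin B
    A ∩ C = spaceCompl B ᶜ∈ (spaceCompl B ᶜ∈ A ∪ spaceCompl B ᶜ∈ C)

    _≼_ : Rel (Space B) a
    _≼_ = SpaceOrder B

    maskOf : ∀ ((F , F∈) : Space B) → HasMask (mask F∈) F
    maskOf (F , F∈) = hasMask F∈

    -- `mask` of a complement is computed through `fromMask∈` and does not reduce to negated bits,
    -- so implication and meet get explicit masks.
    maskOf-⇨ : ∀ ((F , F∈) (G , G∈) : Space B) →
               HasMask (λ i → not (mask F∈ i) ∨ mask G∈ i) ((F ᶜ) ⊔ₛ G)
    maskOf-⇨ A C i = selects-⊔ (selects-ᶜ (maskOf A i)) (maskOf C i)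

    maskOf-∩ : ∀ (A@(F , F∈) C@(G , G∈) : Space B) →
               HasMask (λ i → not (not (mask F∈ i) ∨ not (mask G∈ i))) (proj₁ (A ∩ C))
    maskOf-∩ A C i = selects-ᶜ (selects-⊔ (selects-ᶜ (maskOf A i)) (selects-ᶜ (maskOf C i)))

  space-isPartialOrder : IsPartialOrder (SpaceEq B) (SpaceOrder B)
  space-isPartialOrder = record
    { isPreorder = record
      { isEquivalence = record
        { refl  = λ s t → refl
        ; sym   = λ p s t → sym (p s t)
        ; trans = λ p q s t → trans (p s t) (q s t)
        }
      ; reflexive = λ {A} {C} A≈C →
          -- Transporting membership of `A` along `A≈C` gives `C` the very mask of `A`.
          mask⇒≤ (maskOf A) (hasMask (resp A≈C (proj₂ A))) λ i → bitLe-refl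
      ; trans = λ {A} {C} {D} A≤C C≤D → mask⇒≤ (maskOf A) (maskOf D) λ i →
          bitLe-trans (≤⇒mask (maskOf A) (maskOf C) A≤C i)
                      (≤⇒mask (maskOf C) (maskOf D) C≤D i)
      }
    ; antisym = λ {A} {C} A≤C C≤A s t → agree-everywhere λ i →
        agree-antisym (maskOf A i) (maskOf C i)
          (≤⇒mask (maskOf A) (maskOf C) A≤C i)
          (≤⇒mask (maskOf C) (maskOf A) C≤A i) s t
    }

  space-supremum : Supremum _≼_ _∪_
  space-supremum A C =
    mask⇒≤ (maskOf A) (maskOf (A ∪ C)) (λ i → proj₁ (bitLe-supremum _ _)) ,
    mask⇒≤ (maskOf C) (maskOf (A ∪ C)) (λ i → proj₁ (proj₂ (bitLe-supremum (mask (proj₂ A) i) _))) ,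
    λ D A≤D C≤D → mask⇒≤ (maskOf (A ∪ C)) (maskOf D) λ i →
      proj₂ (proj₂ (bitLe-supremum _ _)) _
        (≤⇒mask (maskOf A) (maskOf D) A≤D i)
        (≤⇒mask (maskOf C) (maskOf D) C≤D i)

  space-infimum : Infimum _≼_ _∩_
  space-infimum A C =
    mask⇒≤ (maskOf-∩ A C) (maskOf A) (λ i → proj₁ (bitLe-infimum _ _)) ,
    mask⇒≤ (maskOf-∩ A C) (maskOf C) (λ i → proj₁ (proj₂ (bitLe-infimum (mask (proj₂ A) i) _))) ,
    λ D D≤A D≤C → mask⇒≤ (maskOf D) (maskOf-∩ A C) λ i →
      proj₂ (proj₂ (bitLe-infimum _ _)) _
        (≤⇒mask (maskOf D) (maskOf A) D≤A i)
        (≤⇒mask (maskOf D) (maskOf C) D≤C i)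

  -- A Boolean algebra is encoded as a Heyting algebra with implication `¬ x ∨ y`; this adjunction
  -- therefore carries the complement laws.
  space-exponential : Exponential _≼_ _∩_ (λ A C → spaceCompl B ᶜ∈ A ∪ C)
  space-exponential A C D =
    (λ A∩C≤D → mask⇒≤ (maskOf A) (maskOf-⇨ C D) λ i →
      proj₁ (bitLe-exponential (mask (proj₂ A) i) _ _) (≤⇒mask A∩C (maskOf D) A∩C≤D i)) ,
    (λ A≤C⇨D → mask⇒≤ A∩C (maskOf D) λ i →
      proj₂ (bitLe-exponential (mask (proj₂ A) i) _ _) (≤⇒mask (maskOf A) (maskOf-⇨ C D) A≤C⇨D i))
    where
    A∩C = maskOf-∩ A C

  space-isBooleanAlgebra :
    IsBooleanAlgebra (SpaceEq B) (SpaceOrder B) _∪_ _∩_ (spaceCompl B ᶜ∈) (⊤ , ⊤∈) (spaceBot B)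
  space-isBooleanAlgebra = record
    { isHeytingAlgebra = record
      { isBoundedLattice = record
        { isLattice = record
          { isPartialOrder = space-isPartialOrder
          ; supremum       = space-supremum
          ; infimum        = space-infimum
          }
        ; maximum = λ A → mask⇒≤ (maskOf A) hasMask-⊤ λ i → bitLe-maximum _
        ; minimum = λ A → mask⇒≤ (hasMask bot) (maskOf A) λ i → tt
        }
      ; exponential = space-exponential
      }
    }

  spaceBoundedLattice : BoundedLattice a a a
  spaceBoundedLattice = record
    { isBoundedLattice = IsBooleanAlgebra.isBoundedLattice space-isBooleanAlgebra }

  -- Enumeration of subsets and completeness.

  space-enumerable : ∀ {p} → ExcludedMiddle (a ⊔ p) →
                     (X : Pred (Space B) p) → ∃[ xs ] Enumerates (SpaceEq B) xs X
  space-enumerable em X =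
    let xs , all , cover = enumerateByCode
          -- The codes of an element are all of its masks; its tabulated `mask` is one of them, so
          -- every member of `X` is covered.
          {R = λ v A → HasMask (lookup v) (proj₁ A)} hasMask-unique X em (masks n)
    in xs , all , λ A → cover (∈-masks (tabulate (mask (proj₂ A))))
         λ i → subst (λ b → Selects i b (proj₁ A)) (sym (lookup∘tabulate _ i)) (maskOf A i)

theorem26 : ∀ {a p : Level} (S : Set a) → S → ∀ (n : ℕ) (B : Basis S n) →
    (∀ F → InSpace B F → IsScene F) ×
    (Σ[ top ∈ InSpace B ⊤ ]
    Σ[ compl ∈ (∀ F → InSpace B F → InSpace B (F ᶜ)) ]
    ∃[ meet ]
    IsBooleanAlgebra (SpaceEq B) (SpaceOrder B) (spaceJoin B) meet
    (spaceCompl B compl) (⊤ , top) (spaceBot B)) ×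
    (∀ (X : Pred (Space B) p) (xs : List (Space B)) →
    Enumerates (SpaceEq B) xs X → IsSupremum (SpaceOrder B) X (⋃ B xs)) ×
    (ExcludedMiddle (a ⊔ p) →
    (∀ (X : Pred (Space B) p) → ∃[ xs ] Enumerates (SpaceEq B) xs X) ×
    IsComplete {p = p} (SpaceOrder B))
theorem26 S _ n B =
  (λ F F∈ → hasMask⇒isScene B (hasMask B F∈)) ,
  (⊤∈ B , ᶜ∈ B , _ , space-isBooleanAlgebra B) ,
  (λ X xs → foldr-supremum boundedJoinSemilattice) ,
  λ em → space-enumerable B em , λ X →
    let xs , enum = space-enumerable B em X in
    (⋃ B xs , foldr-supremum boundedJoinSemilattice enum) ,
    -- The meet of the same list is its join in the dual order, with `⊤` for the empty list.
    (foldr _∧ₛ_ (⊤ , ⊤∈ B) xs ,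
      foldr-supremum (dualBoundedJoinSemilattice boundedMeetSemilattice) enum)
  where
  open BoundedLattice (spaceBoundedLattice B)
    using (boundedJoinSemilattice; boundedMeetSemilattice) renaming (_∧_ to _∧ₛ_)
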